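{- Let $\mathbf{X}$ be a pure simplicial complex of dimension $k\ge -1$ and let $X\subseteq V(\mathbf{X})$. If the pair $(\mathrm{sd}\,\mathbf{X},X)$ is star decomposable in vertices, then the pair $(\mathrm{sd}\,\mathbf{X},X)$ is star decomposable (where $X$ is regarded as a subset of $V(\mathrm{sd}\,\mathbf{X})$ by identifying a vertex $v$ of $\mathbf{X}$ with the vertex $\{v\}$ of $\mathrm{sd}\,\mathbf{X}$).
   Context: Simplicial complexes are finite abstract simplicial complexes; the void complex $\emptyset$ is distinguished from $\{\emptyset\}$ (dimension $-1$). $V(\mathbf{X})$ is the vertex set; pure means all inclusion-wise maximal faces have equal dimension. For a vertex $v$: $\mathrm{lk}(v,\mathbf{X})=\{\sigma\setminus\{v\}: v\in\sigma\in\mathbf{X}\}$, $\mathrm{st}(v,\mathbf{X})=\{\sigma\in\mathbf{X}:\sigma\cup\{v\}\in\mathbf{X}\}$, and $\mathrm{st}(W',\mathbf{X})=\bigcup_{w\in W'}\mathrm{st}(w,\mathbf{X})$ for $W'\subseteq V(\mathbf{X})$. The barycentric subdivision is $\mathrm{sd}\,\mathbf{X}=\{\{\sigma_1,\dots,\sigma_n\}:\ n\ge 0,\ \sigma_i\in\mathbf{X},\ \emptyset\ne\sigma_1\subsetneq\cdots\subsetneq\sigma_n\}$. Star partition: $W\subseteq V(\mathbf{X})$ induces a star partition of $\mathbf{X}$ if $\mathbf{X}=\mathrm{st}(W,\mathbf{X})$ and no two distinct vertices of $W$ are joined by an edge of $\mathbf{X}$. For a total order $\prec$ on $W$ put $W_{\succ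 w}=\{w'\in W:w'\succ w\}$, $W_{\succeq w}=\{w'\in W: w'\succeq w\}$. For $x\in W$, $W'\subseteq W$, the overlap is $\mathbf{O}(x,W')=\mathrm{lk}(x,\mathbf{X})\cap\mathrm{st}(W',\mathbf{X})$. Star decomposability is defined by induction on $k$ for pairs $(\mathbf{X},X)$ with $\mathbf{X}$ pure $k$-dimensional, $k\ge -1$, $X\subseteq V(\mathbf{X})$; $\mathbf{X}$ is star decomposable if $(\mathbf{X},X)$ is star decomposable for some $X\subseteq V(\mathbf{X})$. For $k=-1$, $(\{\emptyset\},\emptyset)$ is star decomposable. For $k\ge 0$, $(\mathbf{X},X)$ is star decomposable if there is a nonempty $W\subseteq V(\mathbf{X})$ inducing a star partition of $\mathbf{X}$ and a total order $\prec$ on $W$ such that: (Order condition) $X=W_{\succeq w'}$ for some $w'\in W$; (Link condition) for every $w\in W$ other than the last vertex of $\prec$, there is a nonempty set $U\subseteq V(\mathrm{lk}(w,\mathbf{X}))$ such that $\mathrm{st}(U,\mathrm{lk}(w,\mathbf{X}))=\mathbf{O}(w,W_{\succ w})$ and the pair $(\mathrm{lk}(w,\mathbf{X}),U)$ is star decomposable; when $k=0$ this condition is regarded as automatically satisfied; (Last vertex condition) for the last vertex $\hat w$ of $\prec$, $\mathrm{lk}(\hat w,\mathbf{X})$ is star decomposable. Star decomposability in vertices is defined by induction on $k$ for pairs $(\mathrm{sd}\,\mathbf{X},X)$ with $\mathbf{X}$ pure $k$-dimensional, $k\ge -1$, and $X\subseteq V(\mathbf{X})$; $\mathrm{sd}\,\mathbf{X}$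 is star decomposable in vertices if $(\mathrm{sd}\,\mathbf{X},V(\mathbf{X}))$ is. For $k=-1$, $(\mathrm{sd}\{\emptyset\},\emptyset)=(\{\emptyset\},\emptyset)$ is star decomposable in vertices. For $k\ge 0$, $(\mathrm{sd}\,\mathbf{X},X)$ is star decomposable in vertices if there is a total order $\prec$ on $V(\mathbf{X})$ such that: (Order condition) $X=\{v\in V(\mathbf{X}): v\succeq w'\}$ for some $w'\in V(\mathbf{X})$; (Link condition) for every $w\in V(\mathbf{X})$ other than the last vertex of $\prec$, the pair $(\mathrm{sd}\,\mathrm{lk}(w,\mathbf{X}),\ \{v\in V(\mathrm{lk}(w,\mathbf{X})): v\succ w\})$ is star decomposable in vertices; (Last vertex condition) for the last vertex $\hat x$ of $\prec$, $\mathrm{sd}\,\mathrm{lk}(\hat x,\mathbf{X})$ is star decomposable in vertices. -}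

module Defs where

open import Data.Bool.Properties as Bool using ()
open import Data.Empty using (⊥-elim)
open import Data.Fin.Base using (Fin; zero; suc; finToFun; funToFin; combine)
open import Data.Fin.Properties
  using (2↔Bool; all?; finToFun-funToFin; funToFin-finToFin)
  renaming (_≟_ to _≟ᶠ_)
open import Data.Fin.Subset
open import Data.Fin.Subset.Properties
open import Data.List.Base using (List; []; _∷_; map; filter; allFin)
open import Data.List.Membership.Propositional using () renaming (_∈_ to _∈ₗ_)
open import Data.List.Membership.Propositional.Properties
  using (∈-map⁺; ∈-map⁻; ∈-filter⁺; ∈-filter⁻; ∈-allFin)
open import Data.List.Relation.Unary.All as All using (All; []; _∷_)
open import Data.List.Relation.Unary.AllPairs using (AllPairs; []; _∷_)
open import Data.List.Relation.Unary.Any using (here; there)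
open import Data.List.Relation.Unary.Linked using (Linked)
open import Data.List.Relation.Unary.Linked.Properties
  using (AllPairs⇒Linked; Linked⇒AllPairs)
open import Data.Nat.Base using (ℕ; zero; suc; _^_; _≤_)
open import Data.Product.Base using (∃; _×_; _,_; proj₁; proj₂)
open import Data.Sum.Base as Sum using (_⊎_; inj₁; inj₂; [_,_]′)
open import Data.Vec.Base as Vec using (lookup; tabulate) renaming (_∷_ to _∷ᵛ_)
open import Data.Vec.Properties using (lookup∘tabulate; tabulate∘lookup; tabulate-cong; ≡-dec)
open import Function.Base using (_∘_; _on_; id)
open import Function.Bundles using (Inverse)
open import Level using (0ℓ)
open import Relation.Binary.Core using (Rel)
open import Relation.Binary.Structures using (IsStrictTotalOrder)
open import Relation.Binary.PropositionalEquality
  using (_≡_; _≢_; refl; sym; trans; cong; cong₂; subst; _≗_)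
open import Relation.Nullary using (¬_; yes; no; contradiction)
open import Relation.Nullary.Decidable using (_×-dec_; _⊎-dec_; _→-dec_; map′)
open import Relation.Unary as U using (Pred; Decidable; _≐_; ∅; Satisfiable)

private
  variable
    n : ℕ

------------------------------------------------------------------------
-- Simplicial complexes

-- A finite abstract simplicial complex whose vertices are among the elements
-- of Fin n; not every element of Fin n has to be a vertex.  The void complex
-- (no faces at all) is allowed, and differs from the complex {⊥}.
record Complex (n : ℕ) : Set₁ where
  field
    Face        : Pred (Subset n) 0ℓ
    face?       : Decidable Face
    down-closed : ∀ {σ τ} → τ ⊆ σ → Face σ → Face τ

open Complex public

V : Complex n → Pred (Fin n) 0ℓ
V X v = Face X ⁅ v ⁆

Maximal : Complex n → Pred (Subset n) 0ℓ
Maximal X σ = Face X σ × (∀ τ → Face X τ → σ ⊆ τ → τ ≡ σ)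

Pure : Complex n → Set
Pure X = ∀ σ τ → Maximal X σ → Maximal X τ → ∣ σ ∣ ≡ ∣ τ ∣

-- Dimensions are shifted by one, so that they start at 0: since a face σ has
-- dimension ∣ σ ∣ - 1, HasDim+1 d X says that X has dimension d - 1.  In
-- particular d = 0 is dimension -1, and d = suc k is dimension k.
HasDim+1 : ℕ → Complex n → Set
HasDim+1 d X = (∃ λ σ → Face X σ × ∣ σ ∣ ≡ d) × (∀ σ → Face X σ → ∣ σ ∣ ≤ d)

PureOfDim+1 : ℕ → Complex n → Set
PureOfDim+1 d X = Pure X × HasDim+1 d X

------------------------------------------------------------------------
-- Links, stars, overlaps

link-down-closed : ∀ (v : Fin n) (X : Complex n) {ρ τ : Subset n} → τ ⊆ ρ →
  (∃ λ σ → v ∈ σ × Face X σ × ρ ≡ σ - v) →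
  (∃ λ σ → v ∈ σ × Face X σ × τ ≡ σ - v)
link-down-closed v X {τ = τ} τ⊆ρ (σ , v∈σ , Xσ , refl) =
  τ ∪ ⁅ v ⁆ , q⊆p∪q τ ⁅ v ⁆ (x∈⁅x⁆ v) , down-closed X τ∪v⊆σ Xσ , ⊆-antisym to from
  where
  τ∪v⊆σ : τ ∪ ⁅ v ⁆ ⊆ σ
  τ∪v⊆σ x∈ with x∈p∪q⁻ τ ⁅ v ⁆ x∈
  ... | inj₁ x∈τ = p─q⊆p σ ⁅ v ⁆ (τ⊆ρ x∈τ)
  ... | inj₂ x∈v with refl ← x∈⁅y⁆⇒x≡y v x∈v = v∈σ

  ∉-removed : ∀ {m} (p q : Subset m) {x} → x ∈ p ─ q → x ∉ q
  ∉-removed (_ ∷ᵛ p) (_ ∷ᵛ q) (Vec.there x∈) (Vec.there x∈q) = ∉-removed p q x∈ x∈q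

  to : τ ⊆ (τ ∪ ⁅ v ⁆) - v
  to x∈τ = x∈p∧x∉q⇒x∈p─q (p⊆p∪q ⁅ v ⁆ x∈τ) (∉-removed σ ⁅ v ⁆ (τ⊆ρ x∈τ))

  from : (τ ∪ ⁅ v ⁆) - v ⊆ τ
  from x∈ with x∈p∪q⁻ τ ⁅ v ⁆ (p─q⊆p (τ ∪ ⁅ v ⁆) ⁅ v ⁆ x∈)
  ... | inj₁ x∈τ = x∈τ
  ... | inj₂ x∈v = contradiction x∈v (∉-removed (τ ∪ ⁅ v ⁆) ⁅ v ⁆ x∈)

lk : Fin n → Complex n → Complex n
lk v X = record
  { Face        = λ τ → ∃ λ σ → v ∈ σ × Face X σ × τ ≡ σ - v
  ; face?       = λ τ → anySubset? λ σ →
                    v ∈? σ ×-dec face? X σ ×-dec ≡-dec Bool._≟_ τ (σ - v)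
  ; down-closed = link-down-closed v X
  }

st : Fin n → Complex n → Pred (Subset n) 0ℓ
st v X σ = Face X σ × Face X (σ ∪ ⁅ v ⁆)

St : Pred (Fin n) 0ℓ → Complex n → Pred (Subset n) 0ℓ
St W X σ = ∃ λ w → W w × st w X σ

O : Complex n → Fin n → Pred (Fin n) 0ℓ → Pred (Subset n) 0ℓ
O X x W = Face (lk x X) U.∩ St W X

InducesStarPartition : Pred (Fin n) 0ℓ → Complex n → Set
InducesStarPartition W X =
  (Face X ≐ St W X) ×
  (∀ u v → W u → W v → u ≢ v → ¬ Face X (⁅ u ⁆ ∪ ⁅ v ⁆))

------------------------------------------------------------------------
-- Barycentric subdivision

-- The vertices of sd X are faces of X, that is, elements of Subset n.  As the
-- vertices of a complex have to be elements of some Fin m, they are numbered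
-- through the bijection between Subset n and Fin (2 ^ n).
module _ {n : ℕ} where

  ⌜_⌝ : Subset n → Fin (2 ^ n)
  ⌜ σ ⌝ = funToFin (Inverse.from 2↔Bool ∘ lookup σ)

  ⌞_⌟ : Fin (2 ^ n) → Subset n
  ⌞ s ⌟ = tabulate (Inverse.to 2↔Bool ∘ finToFun s)

  ⌞⌜_⌝⌟ : (σ : Subset n) → ⌞ ⌜ σ ⌝ ⌟ ≡ σ
  ⌞⌜ σ ⌝⌟ = trans
    (tabulate-cong λ i → trans
      (cong (Inverse.to 2↔Bool) (finToFun-funToFin (Inverse.from 2↔Bool ∘ lookup σ) i))
      (Inverse.strictlyInverseˡ 2↔Bool (lookup σ i)))
    (tabulate∘lookup σ)

  ⌜⌞_⌟⌝ : (s : Fin (2 ^ n)) → ⌜ ⌞ s ⌟ ⌝ ≡ s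
  ⌜⌞ s ⌟⌝ = trans
    (funToFin-cong λ i → trans
      (cong (Inverse.from 2↔Bool) (lookup∘tabulate (Inverse.to 2↔Bool ∘ finToFun {2} {n} s) i))
      (Inverse.strictlyInverseʳ 2↔Bool (finToFun {2} {n} s i)))
    (funToFin-finToFin {n} {2} s)
    where
    funToFin-cong : ∀ {m k} {f g : Fin m → Fin k} → f ≗ g → funToFin f ≡ funToFin g
    funToFin-cong {zero}  f≗g = refl
    funToFin-cong {suc m} f≗g = cong₂ combine (f≗g zero) (funToFin-cong (f≗g ∘ suc))

  ⟦_⟧ : List (Subset n) → Subset (2 ^ n)
  ⟦ σs ⟧ = ⋃ (map (⁅_⁆ ∘ ⌜_⌝) σs)

  sdFace : Complex n → Pred (Subset (2 ^ n)) 0ℓ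
  sdFace X S = ∃ λ σs →
    All (λ σ → Nonempty σ × Face X σ) σs × Linked _⊂_ σs × S ≡ ⟦ σs ⟧

  -- Being a chain of nonempty faces, stated without an enumeration of the chain.
  -- It is equivalent to sdFace, and it makes decidability and closure under
  -- subsets evident.
  IsChain : Complex n → Pred (Subset (2 ^ n)) 0ℓ
  IsChain X S =
    (∀ s → s ∈ S → Nonempty ⌞ s ⌟ × Face X ⌞ s ⌟) ×
    (∀ s t → s ∈ S → t ∈ S → ⌞ s ⌟ ⊆ ⌞ t ⌟ ⊎ ⌞ t ⌟ ⊆ ⌞ s ⌟)

  ∈⟦⟧⁺ : ∀ {σ : Subset n} {σs} → σ ∈ₗ σs → ⌜ σ ⌝ ∈ ⟦ σs ⟧
  ∈⟦⟧⁺ (here refl) = x∈p∪q⁺ (inj₁ (x∈⁅x⁆ _))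
  ∈⟦⟧⁺ (there σ∈) = x∈p∪q⁺ (inj₂ (∈⟦⟧⁺ σ∈))

  ∈⟦⟧⁻ : ∀ (σs : List (Subset n)) {s} → s ∈ ⟦ σs ⟧ → ⌞ s ⌟ ∈ₗ σs
  ∈⟦⟧⁻ []       s∈ = contradiction s∈ ∉⊥
  ∈⟦⟧⁻ (σ ∷ σs) s∈ with x∈p∪q⁻ ⁅ ⌜ σ ⌝ ⁆ ⟦ σs ⟧ s∈
  ... | inj₁ s∈σ with refl ← x∈⁅y⁆⇒x≡y ⌜ σ ⌝ s∈σ = here ⌞⌜ σ ⌝⌟
  ... | inj₂ s∈σs = there (∈⟦⟧⁻ σs s∈σs)

  sdFace⇒IsChain : ∀ (X : Complex n) {S} → sdFace X S → IsChain X S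
  sdFace⇒IsChain X (σs , faces , linked , refl) =
    (λ s s∈ → All.lookup faces (∈⟦⟧⁻ σs s∈)) ,
    (λ s t s∈ t∈ → comparable (Linked⇒AllPairs ⊂-trans linked) (∈⟦⟧⁻ σs s∈) (∈⟦⟧⁻ σs t∈))
    where
    comparable : ∀ {m} {σs : List (Subset m)} {σ τ} → AllPairs _⊂_ σs →
                 σ ∈ₗ σs → τ ∈ₗ σs → σ ⊆ τ ⊎ τ ⊆ σ
    comparable (σ⊂ ∷ _) (here refl) (here refl) = inj₁ id
    comparable (σ⊂ ∷ _) (here refl) (there τ∈)  = inj₁ (proj₁ (All.lookup σ⊂ τ∈))
    comparable (τ⊂ ∷ _) (there σ∈)  (here refl) = inj₂ (proj₁ (All.lookup τ⊂ σ∈))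
    comparable (_ ∷ ps) (there σ∈)  (there τ∈)  = comparable ps σ∈ τ∈

  ⊆⇒≡⊎⊂ : ∀ {σ τ : Subset n} → σ ⊆ τ → σ ≡ τ ⊎ σ ⊂ τ
  ⊆⇒≡⊎⊂ {σ = σ} {τ} σ⊆τ with σ ⊂? τ
  ... | yes σ⊂τ = inj₂ σ⊂τ
  ... | no  σ⊄τ = inj₁ (⊆-antisym σ⊆τ τ⊆σ)
    where
    τ⊆σ : τ ⊆ σ
    τ⊆σ {x} x∈τ with x ∈? σ
    ... | yes x∈σ = x∈σ
    ... | no  x∉σ = ⊥-elim (σ⊄τ (σ⊆τ , x , x∈τ , x∉σ))

  insert : ∀ (σ : Subset n) {τs} → AllPairs _⊂_ τs →
    (∀ {τ} → τ ∈ₗ τs → σ ⊆ τ ⊎ τ ⊆ σ) →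
    ∃ λ ρs → AllPairs _⊂_ ρs × σ ∈ₗ ρs × (∀ {τ} → τ ∈ₗ τs → τ ∈ₗ ρs) ×
             (∀ {ρ} → ρ ∈ₗ ρs → ρ ≡ σ ⊎ ρ ∈ₗ τs)
  insert σ [] _ =
    σ ∷ [] , [] ∷ [] , here refl , (λ ()) , λ { (here eq) → inj₁ eq }
  insert σ {τ ∷ τs} (τ⊂ ∷ τs⊂) cmp with Sum.map ⊆⇒≡⊎⊂ ⊆⇒≡⊎⊂ (cmp (here refl))
  ... | inj₁ (inj₁ refl) = τ ∷ τs , τ⊂ ∷ τs⊂ , here refl , id , inj₂
  ... | inj₂ (inj₁ refl) = τ ∷ τs , τ⊂ ∷ τs⊂ , here refl , id , inj₂
  ... | inj₁ (inj₂ σ⊂τ) =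
    σ ∷ τ ∷ τs , (σ⊂τ ∷ All.map (⊂-trans σ⊂τ) τ⊂) ∷ τ⊂ ∷ τs⊂ , here refl , there ,
    λ { (here eq) → inj₁ eq ; (there ρ∈) → inj₂ ρ∈ }
  ... | inj₂ (inj₂ τ⊂σ) with insert σ τs⊂ (cmp ∘ there)
  ... | ρs , ρs⊂ , σ∈ , τs⊆ρs , ρs⊆ =
    τ ∷ ρs ,
    All.tabulate (λ ρ∈ → [ (λ { refl → τ⊂σ }) , All.lookup τ⊂ ]′ (ρs⊆ ρ∈)) ∷ ρs⊂ ,
    there σ∈ ,
    (λ { (here eq) → here eq ; (there τ∈) → there (τs⊆ρs τ∈) }) ,
    λ { (here eq) → inj₂ (here eq) ; (there ρ∈) → Sum.map id there (ρs⊆ ρ∈) }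

  sort : ∀ (σs : List (Subset n)) →
    (∀ {σ τ} → σ ∈ₗ σs → τ ∈ₗ σs → σ ⊆ τ ⊎ τ ⊆ σ) →
    ∃ λ ρs → AllPairs _⊂_ ρs × (∀ {σ} → σ ∈ₗ σs → σ ∈ₗ ρs) × (∀ {ρ} → ρ ∈ₗ ρs → ρ ∈ₗ σs)
  sort []       _   = [] , [] , id , id
  sort (σ ∷ σs) cmp with sort σs (λ σ∈ τ∈ → cmp (there σ∈) (there τ∈))
  ... | τs , τs⊂ , σs⊆τs , τs⊆σs
    with insert σ τs⊂ (λ τ∈ → cmp (here refl) (there (τs⊆σs τ∈)))
  ... | ρs , ρs⊂ , σ∈ , τs⊆ρs , ρs⊆ =
    ρs , ρs⊂ ,
    (λ { (here refl) → σ∈ ; (there σ∈σs) → τs⊆ρs (σs⊆τs σ∈σs) }) ,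
    λ ρ∈ → [ here , there ∘ τs⊆σs ]′ (ρs⊆ ρ∈)

  IsChain⇒sdFace : ∀ (X : Complex n) {S} → IsChain X S → sdFace X S
  IsChain⇒sdFace X {S} (faces , cmp) with sort elems elems-cmp
    where
    elems : List (Subset n)
    elems = map ⌞_⌟ (filter (_∈? S) (allFin (2 ^ n)))

    elems-cmp : ∀ {σ τ} → σ ∈ₗ elems → τ ∈ₗ elems → σ ⊆ τ ⊎ τ ⊆ σ
    elems-cmp σ∈ τ∈ with ∈-map⁻ ⌞_⌟ σ∈ | ∈-map⁻ ⌞_⌟ τ∈
    ... | s , s∈ , refl | t , t∈ , refl =
      cmp s t (proj₂ (∈-filter⁻ (_∈? S) {xs = allFin (2 ^ n)} s∈))
              (proj₂ (∈-filter⁻ (_∈? S) {xs = allFin (2 ^ n)} t∈))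
  ... | ρs , ρs⊂ , S⊆ρs , ρs⊆S =
    ρs , All.tabulate face , AllPairs⇒Linked ρs⊂ , ⊆-antisym to from
    where
    inS : ∀ {ρ} → ρ ∈ₗ ρs → ∃ λ s → s ∈ S × ρ ≡ ⌞ s ⌟
    inS ρ∈ with s , s∈ , eq ← ∈-map⁻ ⌞_⌟ (ρs⊆S ρ∈) =
      s , proj₂ (∈-filter⁻ (_∈? S) {xs = allFin (2 ^ n)} s∈) , eq

    face : ∀ {ρ} → ρ ∈ₗ ρs → Nonempty ρ × Face X ρ
    face ρ∈ with s , s∈ , refl ← inS ρ∈ = faces s s∈

    to : S ⊆ ⟦ ρs ⟧
    to {s} s∈ = subst (_∈ ⟦ ρs ⟧) ⌜⌞ s ⌟⌝
      (∈⟦⟧⁺ (S⊆ρs (∈-map⁺ ⌞_⌟ (∈-filter⁺ (_∈? S) (∈-allFin s) s∈))))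

    from : ⟦ ρs ⟧ ⊆ S
    from {s} s∈ with t , t∈ , eq ← inS (∈⟦⟧⁻ ρs s∈) =
      subst (_∈ S) (trans (sym ⌜⌞ t ⌟⌝) (trans (cong ⌜_⌝ (sym eq)) ⌜⌞ s ⌟⌝)) t∈

  isChain? : (X : Complex n) → Decidable (IsChain X)
  isChain? X S =
    all? (λ s → s ∈? S →-dec (nonempty? ⌞ s ⌟ ×-dec face? X ⌞ s ⌟)) ×-dec
    all? (λ s → all? λ t → s ∈? S →-dec t ∈? S →-dec
      (⌞ s ⌟ ⊆? ⌞ t ⌟ ⊎-dec ⌞ t ⌟ ⊆? ⌞ s ⌟))

  sd : Complex n → Complex (2 ^ n)
  sd X = record
    { Face        = sdFace X
    ; face?       = λ S → map′ (IsChain⇒sdFace X) (sdFace⇒IsChain X) (isChain? X S)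
    ; down-closed = λ T⊆S S∈ → let faces , cmp = sdFace⇒IsChain X S∈ in
        IsChain⇒sdFace X
          ( (λ s s∈ → faces s (T⊆S s∈))
          , (λ s t s∈ t∈ → cmp s t (T⊆S s∈) (T⊆S t∈)))
    }

  -- A set of vertices v of X, as the set of the vertices {v} of sd X.
  sdVertices : Pred (Fin n) 0ℓ → Pred (Fin (2 ^ n)) 0ℓ
  sdVertices A s = ∃ λ v → A v × s ≡ ⌜ ⁅ v ⁆ ⌝

------------------------------------------------------------------------
-- Total orders on sets of vertices

-- _≺_ restricts to a strict total order on W; its values off W are irrelevant.
IsTotalOrderOn : Pred (Fin n) 0ℓ → Rel (Fin n) 0ℓ → Set
IsTotalOrderOn W _≺_ = IsStrictTotalOrder {A = ∃ W} (_≡_ on proj₁) (_≺_ on proj₁)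

module _ (W : Pred (Fin n) 0ℓ) (_≺_ : Rel (Fin n) 0ℓ) where

  After : Fin n → Pred (Fin n) 0ℓ
  After w v = W v × w ≺ v

  From : Fin n → Pred (Fin n) 0ℓ
  From w v = W v × (w ≺ v ⊎ w ≡ v)

  IsLast : Pred (Fin n) 0ℓ
  IsLast w = W w × (∀ v → W v → v ≺ w ⊎ v ≡ w)

------------------------------------------------------------------------
-- Star decomposability

-- The first argument is the dimension plus one, as for HasDim+1.

data StarDecomposablePair {n} : ℕ → Complex n → Pred (Fin n) 0ℓ → Set₁

StarDecomposable : ℕ → Complex n → Set₁
StarDecomposable d X = ∃ λ A → A U.⊆ V X × StarDecomposablePair d X A

data StarDecomposablePair {n} where

  base : ∀ {X A} → Face X ≐ (_≡ ⊥) → A ≐ ∅ → StarDecomposablePair 0 X A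

  step : ∀ {k X A} →
    PureOfDim+1 (suc k) X →
    (W : Pred (Fin n) 0ℓ) → W U.⊆ V X → Satisfiable W → InducesStarPartition W X →
    (_≺_ : Rel (Fin n) 0ℓ) → IsTotalOrderOn W _≺_ →
    (order : ∃ λ w′ → W w′ × A ≐ From W _≺_ w′) →
    (link : k ≢ 0 → ∀ w → W w → ¬ IsLast W _≺_ w →
      ∃ λ U → Satisfiable U × U U.⊆ V (lk w X) ×
        St U (lk w X) ≐ O X w (After W _≺_ w) ×
        StarDecomposablePair k (lk w X) U) →
    (last : ∀ ŵ → IsLast W _≺_ ŵ → StarDecomposable k (lk ŵ X)) →
    StarDecomposablePair (suc k) X A

-- SdStarDecomposableInVertices d X A is the property, for the pair (sd X , A),
-- of being star decomposable in vertices.  As its definition refers to X and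
-- not only to sd X, it is indexed by X.
data SdStarDecomposableInVertices {n} : ℕ → Complex n → Pred (Fin n) 0ℓ → Set₁ where

  base : ∀ {X A} → Face X ≐ (_≡ ⊥) → A ≐ ∅ → SdStarDecomposableInVertices 0 X A

  step : ∀ {k X A} →
    PureOfDim+1 (suc k) X →
    (_≺_ : Rel (Fin n) 0ℓ) → IsTotalOrderOn (V X) _≺_ →
    (order : ∃ λ w′ → V X w′ × A ≐ From (V X) _≺_ w′) →
    (link : ∀ w → V X w → ¬ IsLast (V X) _≺_ w →
      SdStarDecomposableInVertices k (lk w X) (After (V (lk w X)) _≺_ w)) →
    (last : ∀ x̂ → IsLast (V X) _≺_ x̂ →
      SdStarDecomposableInVertices k (lk x̂ X) (V (lk x̂ X))) →
    SdStarDecomposableInVertices (suc k) X A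

{-# OPTIONS --safe #-}

-- The vertices {v} of sd X, ordered as in X, induce a star partition of sd X:
-- a chain of faces can be extended by any vertex of its least member, and two
-- distinct singletons are incomparable.  The link of {w} in sd X consists of the
-- chains of faces strictly containing w; the involution σ ↦ σ △ {w} of the
-- vertices of sd X identifies it with sd (lk w X), and maps {v} to {v , w}.
-- So star decomposability of the links is the induction hypothesis, transported
-- along that involution.  Purity of sd X follows from purity of these links,
-- since the stars cover sd X.

module Submission where

open import Defs
open import Data.Bool.Base using (not)
open import Data.Bool.Properties using (not-involutive; ¬-not)
open import Data.Fin.Base using (Fin; zero; suc)
open import Data.Fin.Properties using (_≟_; all?; suc-injective)
open import Data.Fin.Subset renaming (_⊆_ to _⊆ₛ_)
open import Data.Fin.Subset.Properties
open import Data.List.Base using ([]; _∷_)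
open import Data.List.Membership.Propositional using () renaming (_∈_ to _∈ₗ_)
open import Data.List.Relation.Unary.All as All using (_∷_)
open import Data.List.Relation.Unary.AllPairs using (_∷_)
open import Data.List.Relation.Unary.Any using (here; there)
open import Data.List.Relation.Unary.Linked.Properties using (Linked⇒AllPairs)
open import Data.Nat.Base using (ℕ; _^_; suc; z≤n; s≤s) renaming (_≤_ to _≤ⁿ_)
import Data.Nat.Properties as ℕ
open import Data.Product.Base using (∃; ∃₂; _×_; _,_; proj₁; proj₂)
open import Data.Sum.Base as Sum using (_⊎_; inj₁; inj₂)
open import Data.Vec.Base as Vec
  using (lookup; tabulate; updateAt) renaming ([] to []ᵛ; _∷_ to _∷ᵛ_)
open import Data.Vec.Properties
  using (lookup∘tabulate; lookup⇒[]=; []=⇒lookup; updateAt-updates; updateAt-minimal;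
         updateAt-updateAt; updateAt-id-local; []=-injective)
open import Function.Base using (_∘_; id)
open import Function.Definitions using (Injective)
open import Level using (0ℓ)
open import Relation.Binary.Core using (Rel)
open import Relation.Binary.Definitions using (tri<; tri≈; tri>)
open import Relation.Binary.Structures using (IsStrictTotalOrder)
open import Relation.Binary.PropositionalEquality
  using (_≡_; _≢_; refl; sym; trans; cong; subst; subst₂)
open import Relation.Nullary using (¬_; Dec; yes; no; contradiction)
open import Relation.Unary using (Pred; _⊆_; _≐_; Satisfiable)

private
  variable
    m n k d : ℕ

-- Subsets of a finite set and their cardinalities

x∈p∪⁅y⁆⁻ : ∀ (p : Subset n) {x y} → x ∈ p ∪ ⁅ y ⁆ → x ∈ p ⊎ x ≡ y
x∈p∪⁅y⁆⁻ p {y = y} x∈ = Sum.map₂ (x∈⁅y⁆⇒x≡y y) (x∈p∪q⁻ p ⁅ y ⁆ x∈)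

y∈p∪⁅y⁆ : ∀ (p : Subset n) y → y ∈ p ∪ ⁅ y ⁆
y∈p∪⁅y⁆ p y = q⊆p∪q p ⁅ y ⁆ (x∈⁅x⁆ y)

⁅x⁆⊆p : ∀ {p : Subset n} {x} → x ∈ p → ⁅ x ⁆ ⊆ₛ p
⁅x⁆⊆p {x = x} x∈p y∈ with refl ← x∈⁅y⁆⇒x≡y x y∈ = x∈p

p∪⁅x⁆⊆q : ∀ {p q : Subset n} {x} → p ⊆ₛ q → x ∈ q → p ∪ ⁅ x ⁆ ⊆ₛ q
p∪⁅x⁆⊆q {p = p} p⊆q x∈q y∈ with x∈p∪⁅y⁆⁻ p y∈
... | inj₁ y∈p  = p⊆q y∈p
... | inj₂ refl = x∈q

p⊆q∪⁅x⁆ : ∀ {p q : Subset n} {x} → (∀ {y} → y ∈ p → y ≢ x → y ∈ q) → p ⊆ₛ q ∪ ⁅ x ⁆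
p⊆q∪⁅x⁆ {q = q} {x} p⊆q {y} y∈p with y ≟ x
... | yes refl = y∈p∪⁅y⁆ q x
... | no  y≢x  = p⊆p∪q ⁅ x ⁆ (p⊆q y∈p y≢x)

x∈p-y⇒x≢y : ∀ (p : Subset n) {x y} → x ∈ p - y → x ≢ y
x∈p-y⇒x≢y (_ ∷ᵛ p) {y = zero}  (Vec.there _)  ()
x∈p-y⇒x≢y (_ ∷ᵛ p) {y = suc y} (Vec.there x∈) eq = x∈p-y⇒x≢y p x∈ (suc-injective eq)

-- Induction on `p`. When zero lies in `p`, its image is removed from `q`; by injectivity the rest
-- of `p` still maps into what remains, and the removal lowers the cardinality of `q` by at least
-- one.
∣p∣≤∣q∣-injection : ∀ (p : Subset m) (q : Subset n) (f : Fin m → Fin n) → Injective _≡_ _≡_ f →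
                    (∀ {x} → x ∈ p → f x ∈ q) → ∣ p ∣ ≤ⁿ ∣ q ∣
∣p∣≤∣q∣-injection []ᵛ            q f inj p⇒q = z≤n
∣p∣≤∣q∣-injection (outside ∷ᵛ p) q f inj p⇒q =
  ∣p∣≤∣q∣-injection p q (f ∘ suc) (suc-injective ∘ inj) (p⇒q ∘ Vec.there)
∣p∣≤∣q∣-injection (inside ∷ᵛ p)  q f inj p⇒q = ℕ.≤-<-trans
  (∣p∣≤∣q∣-injection p (q - f zero) (f ∘ suc) (suc-injective ∘ inj)
    λ x∈p → x∈p∧x≢y⇒x∈p-y (p⇒q (Vec.there x∈p)) (λ eq → contradiction (inj eq) λ ()))
  (x∈p⇒∣p-x∣<∣p∣ (p⇒q Vec.here))

∣p∣≡1+∣p-x∣ : ∀ {p : Subset n} {x} → x ∈ p → ∣ p ∣ ≡ suc ∣ p - x ∣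
∣p∣≡1+∣p-x∣ {p = inside ∷ᵛ p} Vec.here = cong (suc ∘ ∣_∣) (sym (p─⊥≡p p))
∣p∣≡1+∣p-x∣ {p = inside  ∷ᵛ p} (Vec.there x∈p) = cong suc (∣p∣≡1+∣p-x∣ x∈p)
∣p∣≡1+∣p-x∣ {p = outside ∷ᵛ p} (Vec.there x∈p) = ∣p∣≡1+∣p-x∣ x∈p

-- Links and purity

module _ (X : Complex n) {v : Fin n} where

  -- With `lk⁻`, this replaces the existential definition of the link by a condition on `ρ` itself.
  lk⁺ : ∀ {ρ} → v ∉ ρ → Face X (ρ ∪ ⁅ v ⁆) → Face (lk v X) ρ
  lk⁺ {ρ} v∉ρ Xρv = ρ ∪ ⁅ v ⁆ , y∈p∪⁅y⁆ ρ v , Xρv , ⊆-antisym to from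
    where
    to : ρ ⊆ₛ (ρ ∪ ⁅ v ⁆) - v
    to x∈ρ = x∈p∧x≢y⇒x∈p-y (p⊆p∪q ⁅ v ⁆ x∈ρ) λ { refl → v∉ρ x∈ρ }

    from : (ρ ∪ ⁅ v ⁆) - v ⊆ₛ ρ
    from x∈ with x∈p∪⁅y⁆⁻ ρ (p─q⊆p (ρ ∪ ⁅ v ⁆) ⁅ v ⁆ x∈)
    ... | inj₁ x∈ρ  = x∈ρ
    ... | inj₂ refl = contradiction refl (x∈p-y⇒x≢y (ρ ∪ ⁅ v ⁆) x∈)

  lk⁻ : ∀ {ρ} → Face (lk v X) ρ → v ∉ ρ × Face X (ρ ∪ ⁅ v ⁆)
  lk⁻ (σ , v∈σ , Xσ , refl) =
    (λ v∈ → x∈p-y⇒x≢y σ v∈ refl) , down-closed X (p∪⁅x⁆⊆q (p─q⊆p σ ⁅ v ⁆) v∈σ) Xσ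

-- A face `τ` attaining the top cardinality has no proper superset among the faces, so it is maximal
-- and purity compares `σ` with it.
∣maximal∣≡dim : ∀ {X : Complex n} {σ} → PureOfDim+1 d X → Maximal X σ → ∣ σ ∣ ≡ d
∣maximal∣≡dim {σ = σ} (pure , (τ , Xτ , refl) , bound) max = pure σ τ max (Xτ , τ-max)
  where
  τ-max : ∀ ρ → _ → τ ⊆ₛ ρ → ρ ≡ τ
  τ-max ρ Xρ τ⊆ρ with ⊆⇒≡⊎⊂ τ⊆ρ
  ... | inj₁ τ≡ρ = sym τ≡ρ
  ... | inj₂ τ⊂ρ = contradiction (p⊂q⇒∣p∣<∣q∣ τ⊂ρ) (ℕ.≤⇒≯ (bound ρ Xρ))

-- A maximal face lies in the star of some `w` in `W`, hence contains `w`. Deleting `w` leaves a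
-- maximal face of the link, whose cardinality is known to be `k`.
pure-from-links : ∀ {X : Complex n} {W : Pred (Fin n) 0ℓ} → Satisfiable W → Face X ⊆ St W X →
  (∀ w → W w → PureOfDim+1 k (lk w X)) → PureOfDim+1 (suc k) X
pure-from-links {k = k} {X} {W} (w₀ , Ww₀) cover pure-lk =
  (λ σ τ max-σ max-τ → trans (maximal-card {σ} max-σ) (sym (maximal-card {τ} max-τ))) ,
  large , bound
  where
  maximal-card : ∀ {σ} → Maximal X σ → ∣ σ ∣ ≡ suc k
  maximal-card {σ} (Xσ , max) with w , Ww , _ , Xσw ← cover Xσ =
    trans (∣p∣≡1+∣p-x∣ w∈σ) (cong suc (∣maximal∣≡dim {X = lk w X} (pure-lk w Ww) σ-w-max))
    where
    w∈σ : w ∈ σ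
    w∈σ = subst (w ∈_) (max _ Xσw (p⊆p∪q ⁅ w ⁆)) (y∈p∪⁅y⁆ σ w)

    σ-w-max : Maximal (lk w X) (σ - w)
    σ-w-max = (σ , w∈σ , Xσ , refl) , λ ρ lkρ σ-w⊆ρ →
      let w∉ρ , Xρw = lk⁻ X lkρ
          -- Putting `w` back turns a face of the link containing `σ - w` into a face of `X`
          -- containing `σ`.
          ρw≡σ = max (ρ ∪ ⁅ w ⁆) Xρw
            (p⊆q∪⁅x⁆ λ y∈σ y≢w → σ-w⊆ρ (x∈p∧x≢y⇒x∈p-y y∈σ y≢w))
      in ⊆-antisym
        (λ x∈ρ → x∈p∧x≢y⇒x∈p-y (subst (_ ∈_) ρw≡σ (p⊆p∪q ⁅ w ⁆ x∈ρ)) λ { refl → w∉ρ x∈ρ })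
        σ-w⊆ρ

  large : ∃ λ σ → Face X σ × ∣ σ ∣ ≡ suc k
  large with _ , (_ , (σ , w∈σ , Xσ , refl) , card) , _ ← pure-lk w₀ Ww₀ =
    σ , Xσ , trans (∣p∣≡1+∣p-x∣ w∈σ) (cong suc card)

  bound : ∀ σ → Face X σ → ∣ σ ∣ ≤ⁿ suc k
  -- `σ` need not contain `w`, so the bound is obtained for the possibly larger face `σ ∪ ⁅ w ⁆`.
  bound σ Xσ with w , Ww , _ , Xσw ← cover Xσ = ℕ.≤-trans
    (p⊆q⇒∣p∣≤∣q∣ {p = σ} (p⊆p∪q ⁅ w ⁆))
    (subst (_≤ⁿ suc k) (sym (∣p∣≡1+∣p-x∣ w∈))
      (s≤s (proj₂ (proj₂ (pure-lk w Ww)) _ (σ ∪ ⁅ w ⁆ , w∈ , Xσw , refl))))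
    where w∈ = y∈p∪⁅y⁆ σ w

starDecomposable⇒pure : ∀ {X : Complex n} {A} → StarDecomposablePair d X A → PureOfDim+1 d X
starDecomposable⇒pure {n = n} (base {X} (X⇒⊥ , ⊥⇒X) _) =
  (λ σ τ (Xσ , _) (Xτ , _) → cong ∣_∣ (trans (X⇒⊥ Xσ) (sym (X⇒⊥ Xτ)))) ,
  (⊥ , ⊥⇒X refl , ∣⊥∣≡0 n) ,
  λ σ Xσ → ℕ.≤-reflexive (trans (cong ∣_∣ (X⇒⊥ Xσ)) (∣⊥∣≡0 n))
starDecomposable⇒pure (step pure _ _ _ _ _ _ _ _ _) = pure

-- Images of vertex sets and orders under an injection

-- For f = ⌜_⌝ ∘ ⁅_⁆ this is definitionally sdVertices.
Image : (Fin m → Fin n) → Pred (Fin m) 0ℓ → Pred (Fin n) 0ℓ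
Image f A s = ∃ λ v → A v × s ≡ f v

-- Nothing is related outside the range of `f`; this is harmless because `IsTotalOrderOn` looks only
-- at the given vertex set.
Image₂ : (Fin m → Fin n) → Rel (Fin m) 0ℓ → Rel (Fin n) 0ℓ
Image₂ f _≺_ s t = ∃₂ λ u v → u ≺ v × s ≡ f u × t ≡ f v

module _ {f : Fin m → Fin n} (inj : Injective _≡_ _≡_ f) where

  Image⁻ : ∀ {A v} → Image f A (f v) → A v
  Image⁻ (u , Au , eq) with refl ← inj eq = Au

  Image₂⁻ : ∀ {_≺_ u v} → Image₂ f _≺_ (f u) (f v) → u ≺ v
  Image₂⁻ (_ , _ , u≺v , eq , eq′) with refl ← inj eq | refl ← inj eq′ = u≺v

  module _ {W : Pred (Fin m) 0ℓ} {_≺_ : Rel (Fin m) 0ℓ} where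

    isTotalOrderOn-Image : IsTotalOrderOn W _≺_ → IsTotalOrderOn (Image f W) (Image₂ f _≺_)
    isTotalOrderOn-Image isSTO = record
      { isStrictPartialOrder = record
        { isEquivalence = record { refl = refl ; sym = sym ; trans = trans }
        ; irrefl = λ { {_ , u , Wu , refl} {_ , v , Wv , refl} eq u≺v →
            ≺.irrefl {u , Wu} {v , Wv} (inj eq) (Image₂⁻ u≺v) }
        ; trans = λ { {_ , u , Wu , refl} {_ , v , Wv , refl} {_ , w , Ww , refl} u≺v v≺w →
            u , w , ≺.trans {u , Wu} {v , Wv} {w , Ww} (Image₂⁻ u≺v) (Image₂⁻ v≺w) , refl , refl }
        ; <-resp-≈ = (λ { refl → id }) , (λ { refl → id })
        }
      ; compare = λ { (_ , u , Wu , refl) (_ , v , Wv , refl) → compare u Wu v Wv }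
      }
      where
      module ≺ = IsStrictTotalOrder isSTO

      compare : ∀ u Wu v Wv → _
      compare u Wu v Wv with ≺.compare (u , Wu) (v , Wv)
      ... | tri< u≺v u≢v v⊀u =
        tri< (u , v , u≺v , refl , refl) (u≢v ∘ inj) (v⊀u ∘ Image₂⁻)
      ... | tri≈ u⊀v u≡v v⊀u =
        tri≈ (u⊀v ∘ Image₂⁻) (cong f u≡v) (v⊀u ∘ Image₂⁻)
      ... | tri> u⊀v u≢v v≺u =
        tri> (u⊀v ∘ Image₂⁻) (u≢v ∘ inj) (v , u , v≺u , refl , refl)

    After-Image⁺ : ∀ {w v} → After W _≺_ w v → After (Image f W) (Image₂ f _≺_) (f w) (f v)
    After-Image⁺ (Wv , w≺v) = (_ , Wv , refl) , (_ , _ , w≺v , refl , refl)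

    After-Image⁻ : ∀ {w s} → After (Image f W) (Image₂ f _≺_) (f w) s → Image f (After W _≺_ w) s
    After-Image⁻ ((v , Wv , refl) , w≺v) = v , (Wv , Image₂⁻ w≺v) , refl

    IsLast-Image⁺ : ∀ {w} → IsLast W _≺_ w → IsLast (Image f W) (Image₂ f _≺_) (f w)
    IsLast-Image⁺ (Ww , w-last) = (_ , Ww , refl) , λ { _ (v , Wv , refl) →
      Sum.map (λ v≺w → v , _ , v≺w , refl , refl) (cong f) (w-last v Wv) }

    IsLast-Image⁻ : ∀ {w} → IsLast (Image f W) (Image₂ f _≺_) (f w) → IsLast W _≺_ w
    IsLast-Image⁻ (Ww , w-last) =
      Image⁻ Ww , λ v Wv → Sum.map Image₂⁻ inj (w-last (f v) (v , Wv , refl))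

    order-Image : ∀ {A} → (∃ λ w → W w × A ≐ From W _≺_ w) →
      ∃ λ w → Image f W w × Image f A ≐ From (Image f W) (Image₂ f _≺_) w
    order-Image {A} (w , Ww , A⊆ , ⊆A) = f w , (w , Ww , refl) , to , from
      where
      to : Image f A ⊆ From (Image f W) (Image₂ f _≺_) (f w)
      to (v , Av , refl) = let Wv , w≼v = A⊆ Av in
        (v , Wv , refl) , Sum.map (λ w≺v → w , v , w≺v , refl , refl) (cong f) w≼v

      from : From (Image f W) (Image₂ f _≺_) (f w) ⊆ Image f A
      from ((v , Wv , refl) , w≼v) = v , ⊆A (Wv , Sum.map Image₂⁻ inj w≼v) , refl

-- Last and other vertices are governed by different clauses of the definition, so a claim about all
-- links needs this case distinction. Comparability decides the condition at each of the finitely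
-- many vertices.
isLast? : ∀ {W : Pred (Fin n) 0ℓ} {_≺_ : Rel (Fin n) 0ℓ} → (∀ v → Dec (W v)) →
          IsTotalOrderOn W _≺_ → ∀ w → W w → Dec (IsLast W _≺_ w)
isLast? {W = W} {_≺_} W? isSTO w Ww with all? below?
  where
  below? : ∀ v → Dec (W v → v ≺ w ⊎ v ≡ w)
  below? v with W? v
  ... | no ¬Wv = yes λ Wv → contradiction Wv ¬Wv
  ... | yes Wv with IsStrictTotalOrder.compare isSTO (v , Wv) (w , Ww)
  ...   | tri< v≺w _ _     = yes λ _ → inj₁ v≺w
  ...   | tri≈ _ v≡w _     = yes λ _ → inj₂ v≡w
  ...   | tri> v⊀w v≢w _ = no λ v≼w → Sum.[ v⊀w , v≢w ] (v≼w Wv)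
... | yes w-last = yes (Ww , w-last)
... | no ¬w-last = no (¬w-last ∘ proj₂)

-- Transport of star decomposability along an involution

-- The preimage of `S` under `f`, which for an involution is also the image.
permute : (Fin n → Fin n) → Subset n → Subset n
permute f S = tabulate (lookup S ∘ f)

∈-permute⁺ : ∀ {f : Fin n → Fin n} {S x} → f x ∈ S → x ∈ permute f S
∈-permute⁺ {f = f} {S} {x} fx∈S =
  lookup⇒[]= x _ (trans (lookup∘tabulate (lookup S ∘ f) x) ([]=⇒lookup fx∈S))

∈-permute⁻ : ∀ {f : Fin n → Fin n} {S x} → x ∈ permute f S → f x ∈ S
∈-permute⁻ {f = f} {S} {x} x∈ =
  lookup⇒[]= (f x) S (trans (sym (lookup∘tabulate (lookup S ∘ f) x)) ([]=⇒lookup x∈))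

permute-mono : ∀ {f : Fin n → Fin n} {S T} → S ⊆ₛ T → permute f S ⊆ₛ permute f T
permute-mono S⊆T = ∈-permute⁺ ∘ S⊆T ∘ ∈-permute⁻

-- One direction only: for an involution `f`, an isomorphism is a proof of `Preserves f X Y`
-- together with one of `Preserves f Y X`.
record Preserves (f : Fin n → Fin n) (X Y : Complex n) : Set where
  constructor preserves
  field
    face : ∀ S → Face X S → Face Y (permute f S)

open Preserves

module Involution {f : Fin n → Fin n} (f-inv : ∀ x → f (f x) ≡ x) where

  inj : Injective _≡_ _≡_ f
  inj {x} {y} eq = trans (sym (f-inv x)) (trans (cong f eq) (f-inv y))

  permute-involutive : ∀ S → permute f (permute f S) ≡ S
  permute-involutive S = ⊆-antisym
    (subst (_∈ S) (f-inv _) ∘ ∈-permute⁻ ∘ ∈-permute⁻)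
    (∈-permute⁺ ∘ ∈-permute⁺ ∘ subst (_∈ S) (sym (f-inv _)))

  permute-⊥ : permute f ⊥ ≡ ⊥
  permute-⊥ = ⊆-antisym (λ x∈ → contradiction (∈-permute⁻ x∈) ∉⊥) (⊆-min _)

  f∈-permute : ∀ {S x} → x ∈ S → f x ∈ permute f S
  f∈-permute {S} x∈S = ∈-permute⁺ (subst (_∈ S) (sym (f-inv _)) x∈S)

  ∣permute∣ : ∀ S → ∣ permute f S ∣ ≡ ∣ S ∣
  ∣permute∣ S = ℕ.≤-antisym
    (∣p∣≤∣q∣-injection (permute f S) S f inj ∈-permute⁻)
    (∣p∣≤∣q∣-injection S (permute f S) f inj f∈-permute)

  permute-∪⁅⁆ : ∀ S v → permute f S ∪ ⁅ f v ⁆ ⊆ₛ permute f (S ∪ ⁅ v ⁆)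
  permute-∪⁅⁆ S v = p∪⁅x⁆⊆q (permute-mono {f = f} {S = S} (p⊆p∪q ⁅ v ⁆))
    (f∈-permute (y∈p∪⁅y⁆ S v))

  module _ {X Y : Complex n} (X→Y : Preserves f X Y) where

    preserves-V : ∀ {v} → V X v → V Y (f v)
    preserves-V {v} Xv = down-closed Y (⁅x⁆⊆p (f∈-permute (x∈⁅x⁆ v))) (face X→Y _ Xv)

    preserves-lk : ∀ v → Preserves f (lk v X) (lk (f v) Y)
    preserves-lk v = preserves λ S lkS → let v∉S , XSv = lk⁻ X lkS in
      lk⁺ Y (v∉S ∘ subst (_∈ S) (f-inv v) ∘ ∈-permute⁻)
            (down-closed Y (permute-∪⁅⁆ S v) (face X→Y _ XSv))

    preserves-St : ∀ {W W′ : Pred (Fin n) 0ℓ} → (∀ {w} → W w → W′ (f w)) →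
                   ∀ S → St W X S → St W′ Y (permute f S)
    preserves-St W→W′ S (w , Ww , XS , XSw) =
      f w , W→W′ Ww , face X→Y S XS , down-closed Y (permute-∪⁅⁆ S w) (face X→Y _ XSw)

  module _ {X Y : Complex n} (X→Y : Preserves f X Y) (Y→X : Preserves f Y X) where

    preserves-Maximal : ∀ {S} → Maximal X S → Maximal Y (permute f S)
    preserves-Maximal {S} (XS , max) = face X→Y S XS , λ T YT fS⊆T →
      trans (sym (permute-involutive T)) (cong (permute f)
        (max _ (face Y→X T YT) (subst (_⊆ₛ permute f T) (permute-involutive S)
          (permute-mono {f = f} fS⊆T))))

  pureOfDim-iso : ∀ {X Y} → Preserves f X Y → Preserves f Y X →
                  PureOfDim+1 d X → PureOfDim+1 d Y
  pureOfDim-iso X→Y Y→X (pure , (S , XS , card) , bound) =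
    (λ S T max-S max-T → trans (sym (∣permute∣ S)) (trans
      (pure _ _ (preserves-Maximal Y→X X→Y max-S) (preserves-Maximal Y→X X→Y max-T))
      (∣permute∣ T))) ,
    (permute f S , face X→Y S XS , trans (∣permute∣ S) card) ,
    λ S YS → subst (_≤ⁿ _) (∣permute∣ S) (bound _ (face Y→X S YS))

  inducesStarPartition-iso : ∀ {X Y W} → Preserves f X Y → Preserves f Y X →
    InducesStarPartition W X → InducesStarPartition (Image f W) Y
  inducesStarPartition-iso {X} {Y} {W} X→Y Y→X ((cover , _) , separated) =
    -- `S` is the image of the face `permute f S` of `X`, and the star of `X` covering the latter is
    -- carried back to `Y`.
    ( (λ {S} YS → subst (St (Image f W) Y) (permute-involutive S)
        (preserves-St X→Y (λ Ww → _ , Ww , refl) (permute f S) (cover (face Y→X S YS))))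
    , (λ (_ , _ , YS , _) → YS)) ,
    λ { _ _ (u , Wu , refl) (v , Wv , refl) fu≢fv Yuv →
        separated u v Wu Wv (fu≢fv ∘ cong f) (down-closed X
          (p∪⁅x⁆⊆q (⁅x⁆⊆p (∈-permute⁺ (p⊆p∪q ⁅ f v ⁆ (x∈⁅x⁆ (f u)))))
                   (∈-permute⁺ (y∈p∪⁅y⁆ ⁅ f u ⁆ (f v))))
          (face Y→X _ Yuv)) }

  -- Induction on the derivation. The same `f` also exchanges the link of `w` in `X` with the link
  -- of `f w` in `Y`, so the induction hypothesis applies to the links without changing the
  -- involution.
  starDecomposablePair-iso : ∀ {X Y A} → Preserves f X Y → Preserves f Y X →
    StarDecomposablePair d X A → StarDecomposablePair d Y (Image f A)
  starDecomposablePair-iso {Y = Y} X→Y Y→X (base (X⇒⊥ , ⊥⇒X) (A⇒∅ , _)) =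
    base
      ( (λ {S} YS → trans (sym (permute-involutive S))
          (trans (cong (permute f) (X⇒⊥ (face Y→X S YS))) permute-⊥))
      , (λ { refl → subst (Face Y) permute-⊥ (face X→Y ⊥ (⊥⇒X refl)) }))
      ((λ (_ , Av , _) → A⇒∅ Av) , λ ())
  starDecomposablePair-iso {Y = Y} X→Y Y→X
    (step {k} {X} {A} pure W W⊆V (w₀ , Ww₀) partition _≺_ isSTO order link last) =
    step (pureOfDim-iso X→Y Y→X pure) (Image f W)
      (λ { (v , Wv , refl) → preserves-V X→Y (W⊆V Wv) }) (f w₀ , w₀ , Ww₀ , refl)
      (inducesStarPartition-iso X→Y Y→X partition)
      (Image₂ f _≺_) (isTotalOrderOn-Image inj isSTO) (order-Image inj order)
      (λ { k≢0 _ (w , Ww , refl) w-not-last →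
           link-iso w (link k≢0 w Ww (w-not-last ∘ IsLast-Image⁺ inj)) })
      λ { _ fw-last@((w , Ww , refl) , _) → last-iso w (last w (IsLast-Image⁻ inj fw-last)) }
    where
    lk→ : ∀ w → Preserves f (lk w X) (lk (f w) Y)
    lk→ = preserves-lk X→Y

    lk← : ∀ w → Preserves f (lk (f w) Y) (lk w X)
    -- `preserves-lk` lands in the link of `f (f w)`, which is the link of `w`.
    lk← w = subst (λ v → Preserves f (lk (f w) Y) (lk v X)) (f-inv w) (preserves-lk Y→X (f w))

    Image-f : ∀ {B : Pred (Fin n) 0ℓ} {s} → Image f B s → B (f s)
    Image-f {B} (u , Bu , refl) = subst B (sym (f-inv u)) Bu

    link-iso : ∀ w →
      (∃ λ U → Satisfiable U × U ⊆ V (lk w X) ×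
        St U (lk w X) ≐ O X w (After W _≺_ w) × StarDecomposablePair k (lk w X) U) →
      ∃ λ U → Satisfiable U × U ⊆ V (lk (f w) Y) ×
        St U (lk (f w) Y) ≐ O Y (f w) (After (Image f W) (Image₂ f _≺_) (f w)) ×
        StarDecomposablePair k (lk (f w) Y) U
    link-iso w (U , (u₀ , Uu₀) , U⊆V , (to , from) , dec) =
      Image f U , (f u₀ , u₀ , Uu₀ , refl) ,
      (λ { (u , Uu , refl) → preserves-V (lk→ w) (U⊆V Uu) }) ,
      ( (λ {S} StS → subst (O Y (f w) _) (permute-involutive S)
          (let lkS , StS′ = to (preserves-St (lk← w) Image-f S StS) in
           face (lk→ w) _ lkS , preserves-St X→Y (After-Image⁺ inj) _ StS′))
      , (λ {S} (lkS , StS) → subst (St (Image f U) (lk (f w) Y)) (permute-involutive S)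
          (preserves-St (lk→ w) (λ Uu → _ , Uu , refl) _
            (from (face (lk← w) S lkS , preserves-St Y→X (Image-f ∘ After-Image⁻ inj) S StS))))) ,
      starDecomposablePair-iso (lk→ w) (lk← w) dec

    last-iso : ∀ w → StarDecomposable k (lk w X) → StarDecomposable k (lk (f w) Y)
    last-iso w (U , U⊆V , dec) =
      Image f U , (λ { (u , Uu , refl) → preserves-V (lk→ w) (U⊆V Uu) }) ,
      starDecomposablePair-iso (lk→ w) (lk← w) dec

-- Chains of faces and the star partition of the subdivision

⌜⌝-injective : Injective _≡_ _≡_ (⌜_⌝ {n})
⌜⌝-injective {x = σ} {τ} eq = trans (sym ⌞⌜ σ ⌝⌟) (trans (cong ⌞_⌟ eq) ⌞⌜ τ ⌝⌟)

⌜⁅_⁆⌝ : Fin n → Fin (2 ^ n)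
⌜⁅ v ⁆⌝ = ⌜ ⁅ v ⁆ ⌝

⌜⁅⁆⌝-injective : Injective _≡_ _≡_ (⌜⁅_⁆⌝ {n})
⌜⁅⁆⌝-injective {x = u} {v} eq =
  x∈⁅y⁆⇒x≡y v (subst (u ∈_) (⌜⌝-injective eq) (x∈⁅x⁆ u))

Nested : Subset n → Subset n → Set
Nested σ τ = σ ⊆ₛ τ ⊎ τ ⊆ₛ σ

x∈S∪⁅⌜σ⌝⁆⁻ : ∀ (S : Subset (2 ^ n)) (σ : Subset n) {s} →
             s ∈ S ∪ ⁅ ⌜ σ ⌝ ⁆ → s ∈ S ⊎ ⌞ s ⌟ ≡ σ
x∈S∪⁅⌜σ⌝⁆⁻ S σ s∈ = Sum.map₂ (λ { refl → ⌞⌜ σ ⌝⌟ }) (x∈p∪⁅y⁆⁻ S s∈)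

isChain-∪ : ∀ (X : Complex n) {S σ} → IsChain X S → Nonempty σ → Face X σ →
  (∀ s → s ∈ S → Nested ⌞ s ⌟ σ) → IsChain X (S ∪ ⁅ ⌜ σ ⌝ ⁆)
isChain-∪ X {S} {σ} (faces , nested) ne Xσ nested-σ = faces′ , nested′
  where
  faces′ : ∀ s → s ∈ S ∪ ⁅ ⌜ σ ⌝ ⁆ → Nonempty ⌞ s ⌟ × Face X ⌞ s ⌟
  faces′ s s∈ with x∈S∪⁅⌜σ⌝⁆⁻ S σ s∈
  ... | inj₁ s∈S = faces s s∈S
  ... | inj₂ s≡σ = subst Nonempty (sym s≡σ) ne , subst (Face X) (sym s≡σ) Xσ

  nested′ : ∀ s t → s ∈ S ∪ ⁅ ⌜ σ ⌝ ⁆ → t ∈ S ∪ ⁅ ⌜ σ ⌝ ⁆ → Nested ⌞ s ⌟ ⌞ t ⌟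
  nested′ s t s∈ t∈ with x∈S∪⁅⌜σ⌝⁆⁻ S σ s∈ | x∈S∪⁅⌜σ⌝⁆⁻ S σ t∈
  ... | inj₁ s∈S | inj₁ t∈S = nested s t s∈S t∈S
  ... | inj₁ s∈S | inj₂ t≡σ = subst (Nested ⌞ s ⌟) (sym t≡σ) (nested-σ s s∈S)
  ... | inj₂ s≡σ | inj₁ t∈S = subst (λ ρ → Nested ρ ⌞ t ⌟) (sym s≡σ) (Sum.swap (nested-σ t t∈S))
  ... | inj₂ s≡σ | inj₂ t≡σ = inj₁ (subst (_ ∈_) (trans s≡σ (sym t≡σ)))

isChain-⊥ : ∀ (X : Complex n) → IsChain X ⊥
isChain-⊥ X = (λ _ s∈ → contradiction s∈ ∉⊥) , (λ _ _ s∈ → contradiction s∈ ∉⊥)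

sdVertices⊆V : ∀ (X : Complex n) {A} → A ⊆ V X → sdVertices A ⊆ V (sd X)
sdVertices⊆V X A⊆V (v , Av , refl) = down-closed (sd X) (q⊆p∪q ⊥ ⁅ ⌜⁅ v ⁆⌝ ⁆)
  (IsChain⇒sdFace X (isChain-∪ X (isChain-⊥ X) (v , x∈⁅x⁆ v) (A⊆V Av)
    (λ _ s∈ → contradiction s∈ ∉⊥)))

sdVertices-cover : ∀ (X : Complex n) {w} → V X w → Face (sd X) ⊆ St (sdVertices (V X)) (sd X)
-- The empty chain has no least member; the given vertex `w` extends it.
sdVertices-cover X {w} Vw ([] , faces , linked , refl) =
  ⌜⁅ w ⁆⌝ , (w , Vw , refl) , ([] , faces , linked , refl) ,
  IsChain⇒sdFace X (isChain-∪ X (isChain-⊥ X) (w , x∈⁅x⁆ w) Vw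
    (λ _ s∈ → contradiction s∈ ∉⊥))
-- The list is increasing, so a vertex `v` of its head `σ` belongs to every member.
sdVertices-cover {n} X _ sdS@(σ ∷ σs , ((v , v∈σ) , Xσ) ∷ _ , linked , refl) =
  ⌜⁅ v ⁆⌝ , (v , Vv , refl) , sdS ,
  IsChain⇒sdFace X (isChain-∪ X (sdFace⇒IsChain X sdS) (v , x∈⁅x⁆ v) Vv
    (λ s s∈ → inj₂ (⁅x⁆⊆p (v∈ (∈⟦⟧⁻ (σ ∷ σs) s∈)))))
  where
  Vv : V X v
  Vv = down-closed X (⁅x⁆⊆p v∈σ) Xσ

  v∈ : ∀ {τ} → τ ∈ₗ σ ∷ σs → v ∈ τ
  v∈ (here refl) = v∈σ
  v∈ (there τ∈) with σ⊂ ∷ _ ← Linked⇒AllPairs ⊂-trans linked = proj₁ (All.lookup σ⊂ τ∈) v∈σ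

sdVertices-starPartition : ∀ (X : Complex n) → Satisfiable (V X) →
  InducesStarPartition (sdVertices (V X)) (sd X)
sdVertices-starPartition {n} X (w , Vw) =
  (sdVertices-cover X Vw , λ (_ , _ , sdS , _) → sdS) ,
  λ { _ _ (u , _ , refl) (v , _ , refl) u≢v sduv → u≢v (cong ⌜⁅_⁆⌝ (nested⇒≡ {u} {v} sduv)) }
  where
  nested⇒≡ : ∀ {u v : Fin n} → Face (sd X) (⁅ ⌜⁅ u ⁆⌝ ⁆ ∪ ⁅ ⌜⁅ v ⁆⌝ ⁆) → u ≡ v
  nested⇒≡ {u} {v} sduv
    with subst₂ Nested ⌞⌜ ⁅ u ⁆ ⌝⌟ ⌞⌜ ⁅ v ⁆ ⌝⌟
           (proj₂ (sdFace⇒IsChain X sduv) ⌜⁅ u ⁆⌝ ⌜⁅ v ⁆⌝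
             (p⊆p∪q _ (x∈⁅x⁆ _)) (y∈p∪⁅y⁆ ⁅ ⌜⁅ u ⁆⌝ ⁆ _))
  ... | inj₁ u⊆v = x∈⁅y⁆⇒x≡y v (u⊆v (x∈⁅x⁆ u))
  ... | inj₂ v⊆u = sym (x∈⁅y⁆⇒x≡y u (v⊆u (x∈⁅x⁆ v)))

-- Toggling a vertex

-- Inserts `w` into sets avoiding it and deletes it from sets containing it. Both complexes to be
-- compared have their vertices in `Fin (2 ^ n)`, so this one involution serves as the isomorphism
-- and as its inverse.
toggle : Fin n → Subset n → Subset n
toggle w σ = updateAt σ w not

toggle-involutive : ∀ (w : Fin n) σ → toggle w (toggle w σ) ≡ σ
toggle-involutive w σ = trans (updateAt-updateAt w σ) (updateAt-id-local w σ (not-involutive _))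

module _ {w : Fin n} where

  ∈-toggle⁺ : ∀ {σ x} → x ≢ w → x ∈ σ → x ∈ toggle w σ
  ∈-toggle⁺ {σ} x≢w = updateAt-minimal _ w σ x≢w

  ∈-toggle⁻ : ∀ {σ x} → x ≢ w → x ∈ toggle w σ → x ∈ σ
  ∈-toggle⁻ {σ} x≢w = subst (_ ∈_) (toggle-involutive w σ) ∘ ∈-toggle⁺ x≢w

  w∈toggle : ∀ {σ} → w ∉ σ → w ∈ toggle w σ
  w∈toggle {σ} w∉σ = updateAt-updates w σ (lookup⇒[]= w σ (¬-not (w∉σ ∘ lookup⇒[]= w σ)))

  w∉toggle : ∀ {σ} → w ∈ σ → w ∉ toggle w σ
  w∉toggle {σ} w∈σ w∈ = contradiction ([]=-injective w∈ (updateAt-updates w σ w∈σ)) λ ()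

  -- Toggling affects membership of `w` only. The condition at `w` holds when `w` avoids `τ`, and
  -- vacuously when `w` lies in `σ`: these are the two directions of the isomorphism of links.
  toggle-mono : ∀ {σ τ} → (w ∈ toggle w σ → w ∈ toggle w τ) → σ ⊆ₛ τ → toggle w σ ⊆ₛ toggle w τ
  toggle-mono at-w σ⊆τ {x} x∈ with x ≟ w
  ... | yes refl = at-w x∈
  ... | no  x≢w  = ∈-toggle⁺ x≢w (σ⊆τ (∈-toggle⁻ x≢w x∈))

  toggle⊆∪ : ∀ {σ} → toggle w σ ⊆ₛ σ ∪ ⁅ w ⁆
  toggle⊆∪ = p⊆q∪⁅x⁆ λ x∈ x≢w → ∈-toggle⁻ x≢w x∈

  ⁅w⁆⊂toggle : ∀ {σ x} → w ∉ σ → x ∈ σ → ⁅ w ⁆ ⊂ toggle w σ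
  ⁅w⁆⊂toggle {x = x} w∉σ x∈σ =
    ⁅x⁆⊆p (w∈toggle w∉σ) , x , ∈-toggle⁺ x≢w x∈σ , x≢y⇒x∉⁅y⁆ x≢w
    where
    x≢w : x ≢ w
    x≢w refl = w∉σ x∈σ

  toggle⊆ : ∀ {σ τ} → w ∈ τ → σ ⊆ₛ τ → toggle w σ ⊆ₛ τ
  toggle⊆ w∈τ σ⊆τ = p∪⁅x⁆⊆q σ⊆τ w∈τ ∘ toggle⊆∪

toggleᶜ : Fin n → Fin (2 ^ n) → Fin (2 ^ n)
toggleᶜ w s = ⌜ toggle w ⌞ s ⌟ ⌝

toggleᶜ-involutive : ∀ (w : Fin n) s → toggleᶜ w (toggleᶜ w s) ≡ s
toggleᶜ-involutive {n} w s = trans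
  (cong (⌜_⌝ ∘ toggle w) ⌞⌜ toggle w ⌞ s ⌟ ⌝⌟)
  (trans (cong ⌜_⌝ (toggle-involutive w ⌞ s ⌟)) (⌜⌞_⌟⌝ {n} s))

-- Membership of `s` in `permute (toggleᶜ w) S` says that `toggleᶜ w s` lies in `S`; this expresses
-- `⌞ s ⌟` through that member of `S`.
⌞⌟-toggleᶜ : ∀ (w : Fin n) s → ⌞ s ⌟ ≡ toggle w ⌞ toggleᶜ w s ⌟
⌞⌟-toggleᶜ w s = sym (trans
  (cong (toggle w) ⌞⌜ toggle w ⌞ s ⌟ ⌝⌟)
  (toggle-involutive w ⌞ s ⌟))

-- Links of singletons in the subdivision

IsChainAbove : Fin n → Complex n → Pred (Subset (2 ^ n)) 0ℓ
IsChainAbove w X S =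
  (∀ s → s ∈ S → ⁅ w ⁆ ⊂ ⌞ s ⌟) × IsChain X S

module _ (X : Complex n) (w : Fin n) where

  lk⇒isChainAbove : ∀ {S} → Face (lk ⌜⁅ w ⁆⌝ (sd X)) S → IsChainAbove w X S
  lk⇒isChainAbove {S} lkS =
    (λ s → above) , (λ s s∈S → faces s (S⊆ s∈S)) ,
    λ s t s∈S t∈S → nested s t (S⊆ s∈S) (S⊆ t∈S)
    where
    w∉S : ⌜⁅ w ⁆⌝ ∉ S
    w∉S = proj₁ (lk⁻ (sd X) lkS)

    chain : IsChain X (S ∪ ⁅ ⌜⁅ w ⁆⌝ ⁆)
    chain = sdFace⇒IsChain X (proj₂ (lk⁻ (sd X) lkS))

    faces = proj₁ chain
    nested = proj₂ chain

    S⊆ : S ⊆ₛ S ∪ ⁅ ⌜⁅ w ⁆⌝ ⁆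
    S⊆ = p⊆p∪q ⁅ ⌜⁅ w ⁆⌝ ⁆

    nested-w : ∀ {s} → s ∈ S → Nested ⌞ s ⌟ ⁅ w ⁆
    nested-w {s} s∈S = subst (Nested ⌞ s ⌟) ⌞⌜ ⁅ w ⁆ ⌝⌟
      (nested s ⌜⁅ w ⁆⌝ (S⊆ s∈S) (y∈p∪⁅y⁆ S ⌜⁅ w ⁆⌝))

    w∈ : ∀ {s} → s ∈ S → w ∈ ⌞ s ⌟
    w∈ {s} s∈S with nested-w s∈S | proj₁ (faces s (S⊆ s∈S))
    ... | inj₂ w⊆s | _ = w⊆s (x∈⁅x⁆ w)
    -- A nonempty subset of `⁅ w ⁆` still contains `w`.
    ... | inj₁ s⊆w | x , x∈s with refl ← x∈⁅y⁆⇒x≡y w (s⊆w x∈s) = x∈s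

    above : ∀ {s} → s ∈ S → ⁅ w ⁆ ⊂ ⌞ s ⌟
    above {s} s∈S with ⊆⇒≡⊎⊂ (⁅x⁆⊆p (w∈ s∈S))
    ... | inj₂ w⊂s = w⊂s
    -- Equality would put the code of `⁅ w ⁆` into `S`, but a face of the link avoids it.
    ... | inj₁ w≡s = contradiction
      (subst (_∈ S) (trans (sym (⌜⌞_⌟⌝ {n} s)) (cong ⌜_⌝ (sym w≡s))) s∈S) w∉S

  isChainAbove⇒lk : V X w → ∀ {S} → IsChainAbove w X S → Face (lk ⌜⁅ w ⁆⌝ (sd X)) S
  isChainAbove⇒lk Vw (above , chain) = lk⁺ (sd X)
    (λ w∈S → ⊂-irref (sym ⌞⌜ ⁅ w ⁆ ⌝⌟) (above _ w∈S))
    (IsChain⇒sdFace X (isChain-∪ X chain (w , x∈⁅x⁆ w) Vw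
      λ s s∈S → inj₂ (proj₁ (above s s∈S))))

  isChainAbove-∪ : ∀ {S σ} → IsChainAbove w X S → ⁅ w ⁆ ⊂ σ → Face X σ →
    (∀ s → s ∈ S → Nested ⌞ s ⌟ σ) → IsChainAbove w X (S ∪ ⁅ ⌜ σ ⌝ ⁆)
  isChainAbove-∪ {S} {σ} (above , chain) w⊂σ Xσ nested =
    (λ s s∈ → Sum.[ above s , (λ s≡σ → subst (⁅ w ⁆ ⊂_) (sym s≡σ) w⊂σ) ] (x∈S∪⁅⌜σ⌝⁆⁻ S σ s∈)) ,
    isChain-∪ X chain (w , proj₁ w⊂σ (x∈⁅x⁆ w)) Xσ nested

  -- Faces of the link avoid `w`, so toggling inserts it. Inclusions survive, the results are faces
  -- of `X` by definition of the link, and they exceed `⁅ w ⁆` because the original faces are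
  -- nonempty.
  sd-lk→lk-sd : V X w → Preserves (toggleᶜ w) (sd (lk w X)) (lk ⌜⁅ w ⁆⌝ (sd X))
  sd-lk→lk-sd Vw = preserves λ S sdS →
    let faces , nested = sdFace⇒IsChain (lk w X) sdS

        w∉ : ∀ {s} → s ∈ S → w ∉ ⌞ s ⌟
        w∉ s∈S = proj₁ (lk⁻ X (proj₂ (faces _ s∈S)))

        mono : ∀ {s t} → t ∈ S → ⌞ s ⌟ ⊆ₛ ⌞ t ⌟ → toggle w ⌞ s ⌟ ⊆ₛ toggle w ⌞ t ⌟
        mono t∈S = toggle-mono (λ _ → w∈toggle (w∉ t∈S))

        w⊂ : ∀ s → s ∈ permute (toggleᶜ w) S → ⁅ w ⁆ ⊂ ⌞ s ⌟
        w⊂ s s∈ = let ts∈S = ∈-permute⁻ {f = toggleᶜ w} {S} s∈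
                      (x , x∈) , _ = faces _ ts∈S in
          subst (⁅ w ⁆ ⊂_) (sym (⌞⌟-toggleᶜ w s)) (⁅w⁆⊂toggle (w∉ ts∈S) x∈)
    in isChainAbove⇒lk Vw
      ( w⊂
      , (λ s s∈ → let ts∈S = ∈-permute⁻ {f = toggleᶜ w} {S} s∈ in
          (w , proj₁ (w⊂ s s∈) (x∈⁅x⁆ w)) ,
          subst (Face X) (sym (⌞⌟-toggleᶜ w s))
            (down-closed X toggle⊆∪ (proj₂ (lk⁻ X (proj₂ (faces _ ts∈S))))))
      , λ s t s∈ t∈ → let ts∈S = ∈-permute⁻ {f = toggleᶜ w} {S} s∈
                          tt∈S = ∈-permute⁻ {f = toggleᶜ w} {S} t∈ in
          subst₂ Nested (sym (⌞⌟-toggleᶜ w s)) (sym (⌞⌟-toggleᶜ w t))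
            (Sum.map (mono tt∈S) (mono ts∈S) (nested _ _ ts∈S tt∈S)))

  -- Here every member contains `w`, so toggling deletes it; strictness of the inclusion of `⁅ w ⁆`
  -- keeps the result nonempty.
  lk-sd→sd-lk : Preserves (toggleᶜ w) (lk ⌜⁅ w ⁆⌝ (sd X)) (sd (lk w X))
  lk-sd→sd-lk = preserves λ S lkS →
    let above , faces , nested = lk⇒isChainAbove lkS

        w∈ : ∀ {s} → s ∈ S → w ∈ ⌞ s ⌟
        w∈ s∈S = proj₁ (above _ s∈S) (x∈⁅x⁆ w)

        mono : ∀ {s t} → s ∈ S → ⌞ s ⌟ ⊆ₛ ⌞ t ⌟ → toggle w ⌞ s ⌟ ⊆ₛ toggle w ⌞ t ⌟
        mono s∈S = toggle-mono (λ w∈ts → contradiction w∈ts (w∉toggle (w∈ s∈S)))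
    in IsChain⇒sdFace (lk w X)
      ( (λ s s∈ → let ts∈S = ∈-permute⁻ {f = toggleᶜ w} {S} s∈
                      _ , x , x∈ , x∉w = above _ ts∈S in
          subst (λ σ → Nonempty σ × Face (lk w X) σ) (sym (⌞⌟-toggleᶜ w s))
            ( (x , ∈-toggle⁺ (x∉⁅y⁆⇒x≢y x∉w) x∈)
            , lk⁺ X (w∉toggle (w∈ ts∈S))
                (down-closed X
                  (p∪⁅x⁆⊆q (λ y∈ → ∈-toggle⁻ (λ { refl → w∉toggle (w∈ ts∈S) y∈ }) y∈) (w∈ ts∈S))
                  (proj₂ (faces _ ts∈S)))))
      , λ s t s∈ t∈ → let ts∈S = ∈-permute⁻ {f = toggleᶜ w} {S} s∈
                          tt∈S = ∈-permute⁻ {f = toggleᶜ w} {S} t∈ in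
          subst₂ Nested (sym (⌞⌟-toggleᶜ w s)) (sym (⌞⌟-toggleᶜ w t))
            (Sum.map (mono ts∈S) (mono tt∈S) (nested _ _ ts∈S tt∈S)))

  starDecomposable-lk-sd : ∀ (A : Pred (Fin n) 0ℓ) → V X w →
    StarDecomposablePair k (sd (lk w X)) (sdVertices A) →
    StarDecomposablePair k (lk ⌜⁅ w ⁆⌝ (sd X)) (Image (toggleᶜ w) (sdVertices A))
  starDecomposable-lk-sd A Vw =
    Involution.starDecomposablePair-iso (toggleᶜ-involutive w) (sd-lk→lk-sd Vw) lk-sd→sd-lk

  toggled⊆V : ∀ (A : Pred (Fin n) 0ℓ) → V X w → A ⊆ V (lk w X) →
    Image (toggleᶜ w) (sdVertices A) ⊆ V (lk ⌜⁅ w ⁆⌝ (sd X))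
  toggled⊆V A Vw A⊆V (_ , As , refl) =
    Involution.preserves-V (toggleᶜ-involutive w) (sd-lk→lk-sd Vw) (sdVertices⊆V (lk w X) A⊆V As)

-- Overlaps in the subdivision

-- The order condition puts its starting vertex into `A`. This supplies the nonemptiness of `U`
-- demanded by the link condition.
sdStarDecomposable⇒nonempty : ∀ {X : Complex n} {A} → k ≢ 0 →
  SdStarDecomposableInVertices k X A → Satisfiable A
sdStarDecomposable⇒nonempty 0≢0 (base _ _) = contradiction refl 0≢0
sdStarDecomposable⇒nonempty _ (step _ _ _ (w , Vw , _ , ⊇) _ _) = w , ⊇ (Vw , inj₂ refl)

-- The vertices {v , w} of lk {w} (sd X), for v ∈ lk w X after w.
toggled : Complex n → Rel (Fin n) 0ℓ → Fin n → Pred (Fin (2 ^ n)) 0ℓ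
toggled X _≺_ w = Image (toggleᶜ w) (sdVertices (After (V (lk w X)) _≺_ w))

-- Each member of a chain in the link contains `w` and something else. Hence such a nonempty chain
-- can be extended by `{v}` below it exactly when all members contain `{v , w}`, which is when it
-- can be extended by `{v , w}` inside the link.
overlap-sd : ∀ (X : Complex n) (_≺_ : Rel (Fin n) 0ℓ) → IsTotalOrderOn (V X) _≺_ →
  ∀ {w} → V X w → Satisfiable (After (V (lk w X)) _≺_ w) →
  St (toggled X _≺_ w) (lk ⌜⁅ w ⁆⌝ (sd X)) ≐
  O (sd X) ⌜⁅ w ⁆⌝ (After (sdVertices (V X)) (Image₂ ⌜⁅_⁆⌝ _≺_) ⌜⁅ w ⁆⌝)
overlap-sd X _≺_ isSTO {w} Vw (u , Vu , w≺u) = to , from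
  where
  lkV⊆V : V (lk w X) ⊆ V X
  lkV⊆V lkv = down-closed X (p⊆p∪q ⁅ w ⁆) (proj₂ (lk⁻ X lkv))

  ≺⇒≢ : ∀ {v} → V X v → w ≺ v → w ≢ v
  ≺⇒≢ Vv w≺v w≡v = IsStrictTotalOrder.irrefl isSTO {w , Vw} {_ , Vv} w≡v w≺v

  to : St (toggled X _≺_ w) (lk ⌜⁅ w ⁆⌝ (sd X)) ⊆ _
  to {S} (_ , (_ , (v , (lkv , w≺v) , refl) , refl) , lkS , lkSv) =
    lkS , ⌜⁅ v ⁆⌝ , ((v , lkV⊆V lkv , refl) , (w , v , w≺v , refl , refl)) , IsChain⇒sdFace X chain ,
    IsChain⇒sdFace X (isChain-∪ X chain (v , x∈⁅x⁆ v) (lkV⊆V lkv)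
      λ s s∈S → inj₂ (⁅x⁆⊆p (v∈ s∈S)))
    where
    chain = proj₂ (lk⇒isChainAbove X w lkS)
    above-v = lk⇒isChainAbove X w lkSv

    ⌞vw⌟ : ⌞ toggleᶜ w ⌜⁅ v ⁆⌝ ⌟ ≡ toggle w ⁅ v ⁆
    ⌞vw⌟ = trans ⌞⌜ _ ⌝⌟ (cong (toggle w) ⌞⌜ ⁅ v ⁆ ⌝⌟)

    v∈ : ∀ {s} → s ∈ S → v ∈ ⌞ s ⌟
    v∈ {s} s∈S with subst (Nested ⌞ s ⌟) ⌞vw⌟
      (proj₂ (proj₂ above-v) s (toggleᶜ w ⌜⁅ v ⁆⌝) (p⊆p∪q _ s∈S) (y∈p∪⁅y⁆ S _))
    ... | inj₂ vw⊆s = vw⊆s (∈-toggle⁺ (≺⇒≢ (lkV⊆V lkv) w≺v ∘ sym) (x∈⁅x⁆ v))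
    -- The member has an element other than `w`, and inside `{v , w}` that can only be `v`.
    ... | inj₁ s⊆vw with _ , x , x∈s , x∉w ← proj₁ above-v s (p⊆p∪q _ s∈S) =
      subst (_∈ ⌞ s ⌟) (x∈⁅y⁆⇒x≡y v (∈-toggle⁻ (x∉⁅y⁆⇒x≢y x∉w) (s⊆vw x∈s))) x∈s

  from : O (sd X) ⌜⁅ w ⁆⌝ (After (sdVertices (V X)) (Image₂ ⌜⁅_⁆⌝ _≺_) ⌜⁅ w ⁆⌝) ⊆
         St (toggled X _≺_ w) (lk ⌜⁅ w ⁆⌝ (sd X))
  from {S} (lkS , _ , after , sdS , sdSv)
    with v , (Vv , w≺v) , refl ← After-Image⁻ ⌜⁅⁆⌝-injective {_≺_ = _≺_} after | nonempty? S
  -- The empty chain gives no edge from `v` to `w`, so `v` may lie outside the link; the vertex `u`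
  -- of the link is used instead.
  ... | no S-empty =
    toggleᶜ w ⌜⁅ u ⁆⌝ , u-toggled , lkS ,
    down-closed (lk ⌜⁅ w ⁆⌝ (sd X))
      (p∪⁅x⁆⊆q (λ x∈S → contradiction (_ , x∈S) S-empty) (x∈⁅x⁆ _))
      (toggled⊆V X w (After (V (lk w X)) _≺_ w) Vw proj₁ u-toggled)
    where
    u-toggled : toggled X _≺_ w (toggleᶜ w ⌜⁅ u ⁆⌝)
    u-toggled = _ , (u , (Vu , w≺u) , refl) , refl
  ... | yes (s₀ , s₀∈S) =
    toggleᶜ w ⌜⁅ v ⁆⌝ , (_ , (v , (lkv , w≺v) , refl) , refl) , lkS ,
    isChainAbove⇒lk X w Vw (isChainAbove-∪ X w above
      (subst (λ σ → ⁅ w ⁆ ⊂ toggle w σ) (sym ⌞⌜ ⁅ v ⁆ ⌝⌟) (⁅w⁆⊂toggle w∉v (x∈⁅x⁆ v)))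
      (down-closed X (vw⊆ s₀∈S) Xs₀)
      λ s s∈S → inj₂ (vw⊆ s∈S))
    where
    above = lk⇒isChainAbove X w lkS

    Xs₀ : Face X ⌞ s₀ ⌟
    Xs₀ = proj₂ (proj₁ (proj₂ above) s₀ s₀∈S)

    w∉v : w ∉ ⁅ v ⁆
    w∉v = x≢y⇒x∉⁅y⁆ (≺⇒≢ Vv w≺v)

    w∈ : ∀ {s} → s ∈ S → w ∈ ⌞ s ⌟
    w∈ s∈S = proj₁ (proj₁ above _ s∈S) (x∈⁅x⁆ w)

    v∈ : ∀ {s} → s ∈ S → v ∈ ⌞ s ⌟
    v∈ {s} s∈S with subst (Nested ⌞ s ⌟) ⌞⌜ ⁅ v ⁆ ⌝⌟
      (proj₂ (sdFace⇒IsChain X sdSv) s ⌜⁅ v ⁆⌝ (p⊆p∪q _ s∈S) (y∈p∪⁅y⁆ S _))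
    ... | inj₂ v⊆s = v⊆s (x∈⁅x⁆ v)
    ... | inj₁ s⊆v = contradiction (s⊆v (w∈ s∈S)) w∉v

    vw⊆ : ∀ {s} → s ∈ S → toggle w ⌞ ⌜⁅ v ⁆⌝ ⌟ ⊆ₛ ⌞ s ⌟
    vw⊆ {s} s∈S = subst (λ σ → toggle w σ ⊆ₛ ⌞ s ⌟) (sym ⌞⌜ ⁅ v ⁆ ⌝⌟)
      (toggle⊆ (w∈ s∈S) (⁅x⁆⊆p (v∈ s∈S)))

    -- The face `⌞ s₀ ⌟` contains both `v` and `w`, so they are joined by an edge.
    lkv : V (lk w X) v
    lkv = lk⁺ X w∉v (down-closed X (p∪⁅x⁆⊆q (⁅x⁆⊆p (v∈ s₀∈S)) (w∈ s₀∈S)) Xs₀)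

-- The induction on dimension

sd-starDecomposable : ∀ {X : Complex n} {A} →
  SdStarDecomposableInVertices d X A → StarDecomposablePair d (sd X) (sdVertices A)
sd-starDecomposable (base {X} (X⇒⊥ , ⊥⇒X) (A⇒∅ , _)) =
  -- Members of a chain are nonempty faces, and `X` has none, so only the empty chain remains.
  base ( (λ sdS → ⊆-antisym
           (λ {s} s∈S → let (x , x∈s) , Xs = proj₁ (sdFace⇒IsChain X sdS) s s∈S in
             contradiction (subst (x ∈_) (X⇒⊥ Xs) x∈s) ∉⊥)
           (⊆-min _))
       , (λ { refl → IsChain⇒sdFace X (isChain-⊥ X) }))
       ((λ (_ , Av , _) → A⇒∅ Av) , λ ())
sd-starDecomposable {n} (step {k} {X} {A} _ _≺_ isSTO order@(w₀ , Vw₀ , _) link last) =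
  step
    (pure-from-links {X = sd X} (⌜⁅ w₀ ⁆⌝ , w₀ , Vw₀ , refl) (proj₁ (proj₁ starPartition))
      λ { _ (w , Vw , refl) → lk-pure w Vw })
    (sdVertices (V X)) (sdVertices⊆V X id) (⌜⁅ w₀ ⁆⌝ , w₀ , Vw₀ , refl) starPartition
    (Image₂ ⌜⁅_⁆⌝ _≺_) (isTotalOrderOn-Image ⌜⁅⁆⌝-injective isSTO)
    (order-Image ⌜⁅⁆⌝-injective order)
    (λ { k≢0 _ (w , Vw , refl) w-not-last →
         sd-link k≢0 w Vw (w-not-last ∘ IsLast-Image⁺ ⌜⁅⁆⌝-injective) })
    λ { _ ŵ-last@((w , Vw , refl) , _) → sd-last w Vw (IsLast-Image⁻ ⌜⁅⁆⌝-injective ŵ-last) }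
  where
  starPartition : InducesStarPartition (sdVertices (V X)) (sd X)
  starPartition = sdVertices-starPartition X (w₀ , Vw₀)

  sd-link : k ≢ 0 → ∀ w → V X w → ¬ IsLast (V X) _≺_ w →
    ∃ λ U → Satisfiable U × U ⊆ V (lk ⌜⁅ w ⁆⌝ (sd X)) ×
      St U (lk ⌜⁅ w ⁆⌝ (sd X)) ≐
        O (sd X) ⌜⁅ w ⁆⌝ (After (sdVertices (V X)) (Image₂ ⌜⁅_⁆⌝ _≺_) ⌜⁅ w ⁆⌝) ×
      StarDecomposablePair k (lk ⌜⁅ w ⁆⌝ (sd X)) U
  sd-link k≢0 w Vw w-not-last =
    toggled X _≺_ w , (_ , _ , (_ , proj₂ after-w , refl) , refl) ,
    toggled⊆V X w (After (V (lk w X)) _≺_ w) Vw proj₁ , overlap-sd X _≺_ isSTO Vw after-w ,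
    starDecomposable-lk-sd X w (After (V (lk w X)) _≺_ w) Vw
      (sd-starDecomposable (link w Vw w-not-last))
    where
    -- For `k` equal to 0 this set is empty; the link condition is then automatic.
    after-w : Satisfiable (After (V (lk w X)) _≺_ w)
    after-w = sdStarDecomposable⇒nonempty k≢0 (link w Vw w-not-last)

  sd-last : ∀ w → V X w → IsLast (V X) _≺_ w → StarDecomposable k (lk ⌜⁅ w ⁆⌝ (sd X))
  sd-last w Vw w-last =
    Image (toggleᶜ w) (sdVertices (V (lk w X))) , toggled⊆V X w (V (lk w X)) Vw id ,
    starDecomposable-lk-sd X w (V (lk w X)) Vw (sd-starDecomposable (last w w-last))

  lk-pure : ∀ w → V X w → PureOfDim+1 k (lk ⌜⁅ w ⁆⌝ (sd X))
  -- Whichever clause applies to `w`, it makes the link star decomposable with some vertex set, and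
  -- purity comes with that.
  lk-pure w Vw with isLast? (λ v → face? X ⁅ v ⁆) isSTO w Vw
  ... | yes w-last    = let _ , _ , dec = sd-last w Vw w-last in starDecomposable⇒pure dec
  ... | no w-not-last = starDecomposable⇒pure
    (starDecomposable-lk-sd X w (After (V (lk w X)) _≺_ w) Vw
      (sd-starDecomposable (link w Vw w-not-last)))

proposition11 : ∀ {n : ℕ} (d : ℕ) (X : Complex n) (A : Pred (Fin n) 0ℓ) →
    PureOfDim+1 d X → A ⊆ V X →
    SdStarDecomposableInVertices d X A →
    StarDecomposablePair d (sd X) (sdVertices A)
proposition11 _ _ _ _ _ = sd-starDecomposable
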